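{- Let $S_6$ be a Seidel matrix of order $6$ with spectrum $\{[-\sqrt{5}]^3,[\sqrt{5}]^3\}$. For $k\in\{1,2\}$, the Seidel matrices $\pm\left(J_{2k+1}\otimes(S_6-I_6)+I_{6(2k+1)}\right)$ do not contain any regular graph in their switching class; that is, none of these matrices (of orders $18$ and $30$) is equivalent to a Seidel matrix whose ambient graph is regular.
   Context: A Seidel matrix of order $n$ is an $n\times n$ symmetric matrix with zero diagonal and all off-diagonal entries equal to $\pm1$. Two Seidel matrices $S_1,S_2$ of the same order are equivalent if $S_2=PS_1P^T$ for some signed permutation matrix $P$. The ambient graph of $S$ is the simple graph with adjacency matrix $(J-I-S)/2$, where $J$ is the all-ones matrix. The switching class of $S$ is the set of (isomorphism classes of) ambient graphs of Seidel matrices equivalent to $S$. $J_a$ and $I_a$ are the all-ones and identity matrices of order $a$, and $\otimes$ is the Kronecker product. $[\lambda]^a$ in a spectrum means that the eigenvalue $\lambda$ has multiplicity $a$. -}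

module Defs where

open import Algebra.Bundles.Raw using (RawMonoid)
import Algebra.Definitions.RawMonoid as RawMonoidDefs
open import Data.Bool.Base using (Bool; true; false; if_then_else_)
open import Data.Fin.Base using (Fin; quotient; remainder)
open import Data.Fin.Properties using (_≟_)
open import Data.Fin.Subset using (∣_∣)
open import Data.Integer.Base as ℤ using (ℤ; 0ℤ; 1ℤ; -1ℤ)
import Data.Integer.Properties as ℤ
open import Data.List.Base as List using (List)
open import Data.List.Membership.Propositional using (_∈_)
open import Data.List.Relation.Unary.All using (All)
open import Data.List.Relation.Unary.Unique.Propositional using (Unique)
open import Data.Nat.Base as ℕ using (ℕ)
open import Data.Product.Base using (Σ; _×_; _,_; proj₁; proj₂; ∃; ∃-syntax)
open import Data.Product using (∃!)
open import Data.Rational.Base as ℚ using (ℚ; 0ℚ; 1ℚ)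
open import Data.Sum.Base as Sum using (_⊎_; inj₁; inj₂)
open import Data.Vec.Base using (tabulate)
open import Data.Vec.Functional using (Vector)
open import Function.Bundles using (_⇔_)
open import Relation.Binary.PropositionalEquality
  using (_≡_; _≢_; _≗_; refl; sym; trans; cong; cong₂; module ≡-Reasoning)
open import Relation.Nullary using (¬_; Dec; yes; no; does; contradiction)

------------------------------------------------------------------------
-- Integer matrices

Matrix : Set → ℕ → ℕ → Set
Matrix A m n = Vector (Vector A n) m

infix 4 _≋_
_≋_ : ∀ {m n} → Matrix ℤ m n → Matrix ℤ m n → Set
A ≋ B = ∀ i j → A i j ≡ B i j

infixl 6 _⊞_ _⊟_
infixl 7 _⊡_ _⊗_
infix  8 ⊟_ _ᵀ

_⊞_ _⊟_ : ∀ {m n} → Matrix ℤ m n → Matrix ℤ m n → Matrix ℤ m n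
(A ⊞ B) i j = A i j ℤ.+ B i j
(A ⊟ B) i j = A i j ℤ.- B i j

⊟_ : ∀ {m n} → Matrix ℤ m n → Matrix ℤ m n
(⊟ A) i j = ℤ.- A i j

_ᵀ : ∀ {m n} → Matrix ℤ m n → Matrix ℤ n m
(A ᵀ) i j = A j i

_⊡_ : ∀ {l m n} → Matrix ℤ l m → Matrix ℤ m n → Matrix ℤ l n
(A ⊡ B) i k = sum (λ j → A i j ℤ.* B j k)
  where open RawMonoidDefs ℤ.+-0-rawMonoid using (sum)

-- The index i : Fin (p * m) stands for the pair (block, position in block).
_⊗_ : ∀ {p q m n} → Matrix ℤ p q → Matrix ℤ m n →
      Matrix ℤ (p ℕ.* m) (q ℕ.* n)
_⊗_ {p} {q} {m} {n} A B i j =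
  A (quotient m i) (quotient n j) ℤ.* B (remainder {p} m i) (remainder {q} n j)

J I : ∀ n → Matrix ℤ n n
J n i j = 1ℤ
I n i j = if does (i ≟ j) then 1ℤ else 0ℤ

------------------------------------------------------------------------
-- Seidel matrices and equivalence

record IsSeidel {n : ℕ} (S : Matrix ℤ n n) : Set where
  field
    symmetric    : S ᵀ ≋ S
    zeroDiagonal : ∀ i → S i i ≡ 0ℤ
    offDiagonal  : ∀ i j → i ≢ j → S i j ≡ 1ℤ ⊎ S i j ≡ -1ℤ

record Seidel (n : ℕ) : Set where
  field
    matrix   : Matrix ℤ n n
    isSeidel : IsSeidel matrix

  open IsSeidel isSeidel public

open Seidel using (matrix)

record IsSignedPermutation {n : ℕ} (P : Matrix ℤ n n) : Set where
  field
    entries : ∀ i j → P i j ≡ 0ℤ ⊎ (P i j ≡ 1ℤ ⊎ P i j ≡ -1ℤ)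
    rows    : ∀ i → ∃! _≡_ (λ j → P i j ≢ 0ℤ)
    columns : ∀ j → ∃! _≡_ (λ i → P i j ≢ 0ℤ)

Equivalent : ∀ {n} → Seidel n → Seidel n → Set
Equivalent {n} S₁ S₂ =
  Σ (Matrix ℤ n n) λ P →
    IsSignedPermutation P × matrix S₂ ≋ P ⊡ matrix S₁ ⊡ P ᵀ

------------------------------------------------------------------------
-- Simple graphs and switching classes

record Graph (n : ℕ) : Set where
  field
    adjacent    : Fin n → Fin n → Bool
    symmetric   : ∀ i j → adjacent i j ≡ adjacent j i
    irreflexive : ∀ i → adjacent i i ≡ false

  adjacency : Matrix ℤ n n
  adjacency i j = if adjacent i j then 1ℤ else 0ℤ

  degree : Fin n → ℕ
  degree i = ∣ tabulate (adjacent i) ∣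

Regular : ∀ {n} → Graph n → Set
Regular G = ∃[ d ] ∀ i → Graph.degree G i ≡ d

-- adjacency G = (J − I − S) / 2, with the denominator cleared.
IsAmbientGraph : ∀ {n} → Seidel n → Graph n → Set
IsAmbientGraph {n} S G =
  Graph.adjacency G ⊞ Graph.adjacency G ≋ J n ⊟ I n ⊟ matrix S

-- Labelled graphs are used in place of isomorphism classes: permutation
-- matrices are signed permutation matrices, so this predicate is already
-- closed under isomorphism.
InSwitchingClass : ∀ {n} → Seidel n → Graph n → Set
InSwitchingClass S G = ∃[ S′ ] Equivalent S S′ × IsAmbientGraph S′ G

HasRegularInSwitchingClass : ∀ {n} → Seidel n → Set
HasRegularInSwitchingClass S = ∃[ G ] InSwitchingClass S G × Regular G

------------------------------------------------------------------------
-- The subfield ℚ(√5) of ℝ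

-- ⟨ a , b ⟩ is a + b√5; as √5 is irrational, _≡_ is equality in ℝ.
record ℚ√5 : Set where
  constructor ⟨_,_⟩
  field
    rational   : ℚ
    irrational : ℚ

module K where

  infixl 6 _+_
  infixl 7 _*_
  infix  8 -_

  _+_ _*_ : ℚ√5 → ℚ√5 → ℚ√5
  ⟨ a , b ⟩ + ⟨ c , d ⟩ = ⟨ a ℚ.+ c , b ℚ.+ d ⟩
  ⟨ a , b ⟩ * ⟨ c , d ⟩ =
    ⟨ a ℚ.* c ℚ.+ (ℤ.+ 5 ℚ./ 1) ℚ.* (b ℚ.* d) , a ℚ.* d ℚ.+ b ℚ.* c ⟩

  -_ : ℚ√5 → ℚ√5
  - ⟨ a , b ⟩ = ⟨ ℚ.- a , ℚ.- b ⟩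

  0# √5 : ℚ√5
  0# = ⟨ 0ℚ , 0ℚ ⟩
  √5 = ⟨ 0ℚ , 1ℚ ⟩

  fromℤ : ℤ → ℚ√5
  fromℤ z = ⟨ z ℚ./ 1 , 0ℚ ⟩

  +-0-rawMonoid : RawMonoid _ _
  +-0-rawMonoid = record { _≈_ = _≡_ ; _∙_ = _+_ ; ε = 0# }

  open RawMonoidDefs +-0-rawMonoid public using (sum)

------------------------------------------------------------------------
-- Spectra

apply : ∀ {m n} → Matrix ℤ m n → Vector ℚ√5 n → Vector ℚ√5 m
apply M v i = K.sum (λ j → K.fromℤ (M i j) K.* v j)

InEigenspace : ∀ {n} → Matrix ℤ n n → ℚ√5 → Vector ℚ√5 n → Set
InEigenspace M μ v = apply M v ≗ λ i → μ K.* v i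

IsEigenvalue : ∀ {n} → Matrix ℤ n n → ℚ√5 → Set
IsEigenvalue M μ = ∃[ v ] InEigenspace M μ v × ¬ (v ≗ λ _ → K.0#)

combination : ∀ {a n} → Vector ℚ√5 a → Vector (Vector ℚ√5 n) a → Vector ℚ√5 n
combination c b i = K.sum (λ j → c j K.* b j i)

record IsEigenbasis {a n} (M : Matrix ℤ n n) (μ : ℚ√5)
                    (b : Vector (Vector ℚ√5 n) a) : Set where
  field
    eigenvectors : ∀ j → InEigenspace M μ (b j)
    independent  : ∀ c → combination c b ≗ (λ _ → K.0#) → c ≗ λ _ → K.0#
    spanning     : ∀ v → InEigenspace M μ v → ∃[ c ] v ≗ combination c b

-- The dimension of the eigenspace.  For symmetric matrices, the only ones
-- considered here, this is also the multiplicity as a root of the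
-- characteristic polynomial.
HasMultiplicity : ∀ {n} → Matrix ℤ n n → ℚ√5 → ℕ → Set
HasMultiplicity {n} M μ a =
  Σ (Vector (Vector ℚ√5 n) a) (IsEigenbasis M μ)

-- σ lists the distinct eigenvalues with their multiplicities.  Eigenspaces
-- of values in ℚ(√5) have the same dimension over ℚ(√5) as over ℝ, and S is
-- diagonalisable over ℝ, so the last field says that S has no eigenvalues
-- outside ℚ(√5).
record HasSpectrum {n} (S : Seidel n) (σ : List (ℚ√5 × ℕ)) : Set where
  field
    distinct       : Unique (List.map proj₁ σ)
    eigenvalues    : ∀ μ → IsEigenvalue (matrix S) μ ⇔ μ ∈ List.map proj₁ σ
    multiplicities : All (λ (μ , a) → HasMultiplicity (matrix S) μ a) σ
    total          : List.sum (List.map proj₂ σ) ≡ n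

------------------------------------------------------------------------
-- The matrices −S and Jₘ ⊗ (S − Iₙ) + Iₘₙ

negate : ∀ {n} → Seidel n → Seidel n
negate S = record
  { matrix   = ⊟ matrix S
  ; isSeidel = record
    { symmetric    = λ i j → cong ℤ.-_ (S.symmetric i j)
    ; zeroDiagonal = λ i → cong ℤ.-_ (S.zeroDiagonal i)
    ; offDiagonal  = λ i j i≢j → off (S.offDiagonal i j i≢j)
    }
  }
  where
  module S = Seidel S
  off : ∀ {x} → x ≡ 1ℤ ⊎ x ≡ -1ℤ → ℤ.- x ≡ 1ℤ ⊎ ℤ.- x ≡ -1ℤ
  off (inj₁ refl) = inj₂ refl
  off (inj₂ refl) = inj₁ refl

I-diagonal : ∀ {n} (i : Fin n) → I n i i ≡ 1ℤ
I-diagonal i with i ≟ i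
... | yes _  = refl
... | no i≢i = contradiction refl i≢i

I-offDiagonal : ∀ {n} {i j : Fin n} → i ≢ j → I n i j ≡ 0ℤ
I-offDiagonal {i = i} {j} i≢j with i ≟ j
... | yes i≡j = contradiction i≡j i≢j
... | no _    = refl

I-symmetric : ∀ {n} (i j : Fin n) → I n j i ≡ I n i j
I-symmetric i j with i ≟ j
... | yes refl = I-diagonal i
... | no i≢j   = I-offDiagonal (λ j≡i → i≢j (sym j≡i))

J⊗[_-I]+I : ∀ {n} → Seidel n → ∀ m → Seidel (m ℕ.* n)
J⊗[_-I]+I {n} S m = record
  { matrix   = M
  ; isSeidel = record
    { symmetric    = M-symmetric
    ; zeroDiagonal = M-diagonal
    ; offDiagonal  = M-offDiagonal
    }
  }
  where
  module S = Seidel S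

  M : Matrix ℤ (m ℕ.* n) (m ℕ.* n)
  M = J m ⊗ (matrix S ⊟ I n) ⊞ I (m ℕ.* n)

  r : Fin (m ℕ.* n) → Fin n
  r = remainder {m} n

  M-symmetric : M ᵀ ≋ M
  M-symmetric i j = cong₂ ℤ._+_
    (cong (1ℤ ℤ.*_) (cong₂ ℤ._-_ (S.symmetric (r i) (r j))
                                 (I-symmetric (r i) (r j))))
    (I-symmetric i j)

  M-diagonal : ∀ i → M i i ≡ 0ℤ
  M-diagonal i
    rewrite S.zeroDiagonal (r i) | I-diagonal (r i) | I-diagonal i = refl

  differentPosition : ∀ {x y z} → y ≡ 0ℤ → z ≡ 0ℤ →
                      1ℤ ℤ.* (x ℤ.- y) ℤ.+ z ≡ x
  differentPosition {x} refl refl = begin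
    1ℤ ℤ.* (x ℤ.+ 0ℤ) ℤ.+ 0ℤ  ≡⟨ ℤ.+-identityʳ _ ⟩
    1ℤ ℤ.* (x ℤ.+ 0ℤ)         ≡⟨ ℤ.*-identityˡ _ ⟩
    x ℤ.+ 0ℤ                  ≡⟨ ℤ.+-identityʳ x ⟩
    x                         ∎
    where open ≡-Reasoning

  samePosition : ∀ {x y z} → x ≡ 0ℤ → y ≡ 1ℤ → z ≡ 0ℤ →
                 1ℤ ℤ.* (x ℤ.- y) ℤ.+ z ≡ -1ℤ
  samePosition refl refl refl = refl

  S-diagonal : ∀ {a b} → a ≡ b → matrix S a b ≡ 0ℤ
  S-diagonal {a} refl = S.zeroDiagonal a

  I-diagonal′ : ∀ {a b : Fin n} → a ≡ b → I n a b ≡ 1ℤ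
  I-diagonal′ {a} refl = I-diagonal a

  M-offDiagonal : ∀ i j → i ≢ j → M i j ≡ 1ℤ ⊎ M i j ≡ -1ℤ
  M-offDiagonal i j i≢j = cases (r i ≟ r j)
    where
    cases : Dec (r i ≡ r j) → M i j ≡ 1ℤ ⊎ M i j ≡ -1ℤ
    cases (yes p) =
      inj₂ (samePosition (S-diagonal p) (I-diagonal′ p) (I-offDiagonal i≢j))
    cases (no ¬p) = Sum.map (trans M≡S) (trans M≡S) (S.offDiagonal (r i) (r j) ¬p)
      where
      M≡S : M i j ≡ matrix S (r i) (r j)
      M≡S = differentPosition (I-offDiagonal ¬p) (I-offDiagonal i≢j)

{-# OPTIONS --safe #-}

-- A regular graph in the switching class of T yields a ±1 vector x with
-- T x = c x.  For T = J_m ⊗ (S − I) + I, adding the m blocks of this equation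
-- gives m S y = (m + c − 1) y, where y is the sum of the m blocks of x.  If m
-- is odd, the entries of y are odd, so y ≠ 0 and S has a rational eigenvalue;
-- but the eigenvalues of S₆ are ±√5.

module Submission where

open import Defs
open import Data.Bool.Base using (Bool; true; false; if_then_else_)
open import Data.Fin.Base using (Fin; zero; suc; combine; _↑ˡ_; _↑ʳ_; remainder)
open import Data.Fin.Properties using (punchInᵢ≢i; remQuot-combine)
open import Data.Fin.Subset using (∣_∣)
open import Data.Integer.Base as ℤ using (ℤ; +_; 0ℤ; 1ℤ; -1ℤ)
import Data.Integer.Properties as ℤ
open import Data.Integer.Tactic.RingSolver using (solve-∀)
open import Data.List.Base using ([]; _∷_)
open import Data.List.Relation.Unary.Any using (here; there)
open import Data.Nat.Base as ℕ using (ℕ; zero; suc; _+_; _*_)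
open import Data.Nat.Divisibility using (_∣_; divides; _∣0; ∣m+n∣m⇒∣n; m∣m*n; >⇒∤)
import Data.Nat.Properties as ℕ
open import Data.Product.Base using (_×_; _,_; proj₁; proj₂; ∃; ∃₂)
open import Data.Rational.Base as ℚ using (ℚ; 0ℚ; _/_)
import Data.Rational.Properties as ℚ
open import Data.Rational.Unnormalised.Base as ℚᵘ using (mkℚᵘ; *≡*)
import Data.Rational.Unnormalised.Properties as ℚᵘ
open import Data.Sum.Base using (_⊎_; inj₁; inj₂)
open import Data.Vec.Base using (tabulate)
open import Data.Vec.Functional using (Vector; removeAt)
open import Function.Base using (_∘_)
open import Function.Bundles using (module Equivalence)
open import Relation.Binary.PropositionalEquality
  using (_≡_; _≢_; _≗_; refl; sym; trans; cong; cong₂; module ≡-Reasoning)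
open import Relation.Nullary using (¬_; contradiction)
open import Relation.Nullary.Decidable using (decidable-stable)

open import Algebra.Bundles using (module CommutativeSemiring)
open import Algebra.Properties.Semiring.Sum
  (CommutativeSemiring.semiring ℤ.+-*-commutativeSemiring)
  using (sum; sum-cong-≗; sum-remove; sum-replicate-zero; ∑-distrib-+; ∑-comm;
         *-distribˡ-sum; *-distribʳ-sum)

open Seidel using (matrix)

private
  variable
    m n : ℕ

-- Integer vectors

infixr 7 _·_
_·_ : Matrix ℤ m n → Vector ℤ n → Vector ℤ m
(A · x) i = sum (λ j → A i j ℤ.* x j)

IsEigenvector : Matrix ℤ n n → ℤ → Vector ℤ n → Set
IsEigenvector M c x = ∀ i → (M · x) i ≡ c ℤ.* x i

IsSign : ℤ → Set
IsSign z = z ≡ 1ℤ ⊎ z ≡ -1ℤ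

sign²≡1 : ∀ {z} → IsSign z → z ℤ.* z ≡ 1ℤ
sign²≡1 (inj₁ refl) = refl
sign²≡1 (inj₂ refl) = refl

-- Finite sums of integers and parity of sums of signs

sum-supported : (f : Vector ℤ n) (i : Fin n) →
                (∀ j → i ≢ j → f j ≡ 0ℤ) → sum f ≡ f i
sum-supported {suc n} f i f≡0 = begin
  sum f                          ≡⟨ sum-remove {i = i} f ⟩
  f i ℤ.+ sum (removeAt f i)     ≡⟨ cong (ℤ._+_ (f i)) (sum-cong-≗ (λ j → f≡0 _ (punchInᵢ≢i i j ∘ sym))) ⟩
  f i ℤ.+ sum {n} (λ _ → 0ℤ)     ≡⟨ cong (ℤ._+_ (f i)) (sum-replicate-zero n) ⟩
  f i ℤ.+ 0ℤ                     ≡⟨ ℤ.+-identityʳ (f i) ⟩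
  f i                            ∎
  where open ≡-Reasoning

sum-const : ∀ m z → sum {m} (λ _ → z) ≡ + m ℤ.* z
sum-const zero    z = refl
sum-const (suc m) z = begin
  z ℤ.+ sum {m} (λ _ → z)  ≡⟨ cong (ℤ._+_ z) (sum-const m z) ⟩
  z ℤ.+ + m ℤ.* z          ≡⟨ ℤ.suc-* (+ m) z ⟨
  + suc m ℤ.* z            ∎
  where open ≡-Reasoning

sum-indicator : (f : Fin n → Bool) →
                sum (λ j → if f j then 1ℤ else 0ℤ) ≡ + ∣ tabulate f ∣
sum-indicator {zero}  f = refl
sum-indicator {suc n} f with f zero
... | true  = cong (ℤ._+_ 1ℤ) (sum-indicator (f ∘ suc))
... | false = trans (ℤ.+-identityˡ _) (sum-indicator (f ∘ suc))

-- The witness `h` counts the entries equal to -1: changing each of them to 1 raises the sum by 2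
-- and ends at `m`. Hence the sum has the parity of `m`.
sum-signs : (x : Vector ℤ m) → (∀ i → IsSign (x i)) →
            ∃ λ h → sum x ℤ.+ (+ h ℤ.+ + h) ≡ + m
sum-signs {zero}  x ±x = 0 , refl
sum-signs {suc m} x ±x with sum-signs (x ∘ suc) (±x ∘ suc) | x zero | ±x zero
... | h , eq | _ | inj₁ refl =
      h , trans (ℤ.+-assoc 1ℤ (sum (x ∘ suc)) (+ h ℤ.+ + h)) (cong (ℤ._+_ 1ℤ) eq)
... | h , eq | _ | inj₂ refl =
      suc h , trans (shift (sum (x ∘ suc)) (+ h)) (cong (ℤ._+_ 1ℤ) eq)
  where
  shift : ∀ s h → -1ℤ ℤ.+ s ℤ.+ ((1ℤ ℤ.+ h) ℤ.+ (1ℤ ℤ.+ h)) ≡ 1ℤ ℤ.+ (s ℤ.+ (h ℤ.+ h))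
  shift = solve-∀

sum-signs≢0 : ¬ 2 ∣ m → (x : Vector ℤ m) → (∀ i → IsSign (x i)) → sum x ≢ 0ℤ
sum-signs≢0 {m} 2∤m x ±x sum≡0 with sum-signs x ±x
... | h , eq = 2∤m (divides h (begin
  m          ≡⟨ ℤ.+-injective (trans (sym eq) (cong (ℤ._+ (+ h ℤ.+ + h)) sum≡0)) ⟩
  h + h      ≡⟨ cong (ℕ._+_ h) (ℕ.+-identityʳ h) ⟨
  2 * h      ≡⟨ ℕ.*-comm 2 h ⟩
  h * 2      ∎))
  where open ≡-Reasoning

-- The range splits into `m` consecutive blocks of length `n`. The two sums are then exchanged, so
-- that the inner one runs over the blocks at a fixed position, as in `blockSum`.
sum-combine : ∀ m {n} (f : Vector ℤ (m * n)) →
              sum f ≡ sum {n} (λ a → sum {m} (λ b → f (combine b a)))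
sum-combine m {n} f = trans (blocks m f) (∑-comm {m} {n} (λ b a → f (combine b a)))
  where
  split : ∀ n {p} (g : Vector ℤ (n + p)) →
          sum g ≡ sum (λ a → g (a ↑ˡ p)) ℤ.+ sum (λ i → g (n ↑ʳ i))
  split zero    g = sym (ℤ.+-identityˡ _)
  split (suc n) g = trans (cong (ℤ._+_ (g zero)) (split n (g ∘ suc))) (sym (ℤ.+-assoc (g zero) _ _))

  blocks : ∀ m (f : Vector ℤ (m * n)) →
           sum f ≡ sum {m} (λ b → sum {n} (λ a → f (combine b a)))
  blocks zero    f = refl
  blocks (suc m) f = trans (split n f) (cong (ℤ._+_ (sum (λ a → f (a ↑ˡ m * n)))) (blocks m (λ i → f (n ↑ʳ i))))

-- Matrix-vector products

I·x≡x : (x : Vector ℤ n) → I n · x ≗ x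
I·x≡x {n} x i = begin
  (I n · x) i        ≡⟨ sum-supported _ i (λ j i≢j → cong (ℤ._* x j) (I-offDiagonal i≢j)) ⟩
  I n i i ℤ.* x i    ≡⟨ cong (ℤ._* x i) (I-diagonal i) ⟩
  1ℤ ℤ.* x i         ≡⟨ ℤ.*-identityˡ (x i) ⟩
  x i                ∎
  where open ≡-Reasoning

·-distrib-⊞ : (A B : Matrix ℤ m n) (x : Vector ℤ n) →
              (A ⊞ B) · x ≗ λ i → (A · x) i ℤ.+ (B · x) i
·-distrib-⊞ A B x i = trans
  (sum-cong-≗ (λ j → ℤ.*-distribʳ-+ (x j) (A i j) (B i j)))
  (∑-distrib-+ (λ j → A i j ℤ.* x j) _)

⊟-· : (A : Matrix ℤ m n) (x : Vector ℤ n) → (⊟ A) · x ≗ λ i → ℤ.- (A · x) i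
⊟-· A x i = begin
  sum (λ j → ℤ.- A i j ℤ.* x j)       ≡⟨ sum-cong-≗ (λ j → neg-* (A i j) (x j)) ⟩
  sum (λ j → -1ℤ ℤ.* (A i j ℤ.* x j)) ≡⟨ *-distribˡ-sum -1ℤ (λ j → A i j ℤ.* x j) ⟨
  -1ℤ ℤ.* (A · x) i                   ≡⟨ ℤ.-1*i≡-i _ ⟩
  ℤ.- (A · x) i                       ∎
  where
  open ≡-Reasoning
  neg-* : ∀ a b → ℤ.- a ℤ.* b ≡ -1ℤ ℤ.* (a ℤ.* b)
  neg-* = solve-∀

-- Regular graphs and ±1 eigenvectors

module _ {P : Matrix ℤ n n} (isP : IsSignedPermutation P) where
  open IsSignedPermutation isP

  nonzero-entry : ∀ {i j} → P i j ≢ 0ℤ → IsSign (P i j)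
  nonzero-entry {i} {j} P≢0 with entries i j
  ... | inj₁ P≡0 = contradiction P≡0 P≢0
  ... | inj₂ ±P  = ±P

  row-zero : ∀ {i j} → P i j ≢ 0ℤ → ∀ k → j ≢ k → P i k ≡ 0ℤ
  row-zero {i} P≢0 k j≢k with rows i
  -- Uniqueness only refutes `P i k ≢ 0ℤ`; decidable equality on the integers removes the double
  -- negation.
  ... | _ , _ , unique = decidable-stable (P i k ℤ.≟ 0ℤ)
    (λ Pik≢0 → j≢k (trans (sym (unique P≢0)) (unique Pik≢0)))

  column-zero : ∀ {i j} → P i j ≢ 0ℤ → ∀ k → i ≢ k → P k j ≡ 0ℤ
  column-zero {i} {j} P≢0 k i≢k with columns j
  ... | _ , _ , unique = decidable-stable (P k j ℤ.≟ 0ℤ)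
    (λ Pkj≢0 → i≢k (trans (sym (unique P≢0)) (unique Pkj≢0)))

  -- Row sums are the product with the all-ones vector 1, and P S Pᵀ 1 = P (S (Pᵀ 1)), where Pᵀ 1 is
  -- the vector of column sums of `P`.
  row-sum-PSPᵀ : (S : Matrix ℤ n n) → ∀ i →
                 sum ((P ⊡ S ⊡ P ᵀ) i) ≡ (P · S · λ l → sum (λ k → P k l)) i
  row-sum-PSPᵀ S i = begin
    sum (λ k → sum (λ l → (P ⊡ S) i l ℤ.* P k l))
      ≡⟨ ∑-comm (λ k l → (P ⊡ S) i l ℤ.* P k l) ⟩
    sum (λ l → sum (λ k → (P ⊡ S) i l ℤ.* P k l))
      ≡⟨ sum-cong-≗ (λ l → *-distribˡ-sum ((P ⊡ S) i l) (λ k → P k l)) ⟨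
    sum (λ l → (P ⊡ S) i l ℤ.* x l)
      ≡⟨ sum-cong-≗ (λ l → *-distribʳ-sum (x l) (λ j → P i j ℤ.* S j l)) ⟩
    sum (λ l → sum (λ j → P i j ℤ.* S j l ℤ.* x l))
      ≡⟨ ∑-comm (λ l j → P i j ℤ.* S j l ℤ.* x l) ⟩
    sum (λ j → sum (λ l → P i j ℤ.* S j l ℤ.* x l))
      ≡⟨ sum-cong-≗ (λ j → sum-cong-≗ (λ l → ℤ.*-assoc (P i j) (S j l) (x l))) ⟩
    sum (λ j → sum (λ l → P i j ℤ.* (S j l ℤ.* x l)))
      ≡⟨ sum-cong-≗ (λ j → *-distribˡ-sum (P i j) (λ l → S j l ℤ.* x l)) ⟨
    (P · S · x) i ∎
    where
    open ≡-Reasoning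
    x : Vector ℤ n
    x l = sum (λ k → P k l)

  -- Take x = Pᵀ 1. Constant row sums say P S x = c 1, and multiplying by Pᵀ, the inverse of `P`,
  -- gives S x = c Pᵀ 1 = c x. The proof does this one coordinate at a time, through the single
  -- nonzero entry `p j` of column `j`.
  constant-row-sums⇒±1-eigenvector :
    (S : Matrix ℤ n n) (c : ℤ) → (∀ i → sum ((P ⊡ S ⊡ P ᵀ) i) ≡ c) →
    ∃ λ x → (∀ i → IsSign (x i)) × IsEigenvector S c x
  constant-row-sums⇒±1-eigenvector S c sums≡c = x , ±x , Sx≡cx
    where
    open ≡-Reasoning

    x : Vector ℤ n
    x l = sum (λ k → P k l)

    row : Fin n → Fin n
    row j = proj₁ (columns j)

    p : Vector ℤ n
    p j = P (row j) j

    p≢0 : ∀ j → p j ≢ 0ℤ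
    p≢0 j = proj₁ (proj₂ (columns j))

    ±p : ∀ j → IsSign (p j)
    ±p j = nonzero-entry (p≢0 j)

    x≡p : ∀ j → x j ≡ p j
    x≡p j = sum-supported (λ k → P k j) (row j) (column-zero (p≢0 j))

    ±x : ∀ j → IsSign (x j)
    ±x j rewrite x≡p j = ±p j

    -- Row `row j` of `P` is zero outside column `j`, so the row sum there reduces to one term.
    pSx≡c : ∀ j → p j ℤ.* (S · x) j ≡ c
    pSx≡c j = begin
      p j ℤ.* (S · x) j
        ≡⟨ sum-supported (λ k → P (row j) k ℤ.* (S · x) k) j
             (λ k j≢k → cong (ℤ._* (S · x) k) (row-zero (p≢0 j) k j≢k)) ⟨
      (P · S · x) (row j)             ≡⟨ row-sum-PSPᵀ S (row j) ⟨
      sum ((P ⊡ S ⊡ P ᵀ) (row j))     ≡⟨ sums≡c (row j) ⟩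
      c                               ∎

    rearrange : ∀ a b → a ℤ.* a ℤ.* b ≡ a ℤ.* b ℤ.* a
    rearrange = solve-∀

    -- Since `p j` is its own inverse, multiplying `pSx≡c` by it isolates the coordinate of S x.
    Sx≡cx : IsEigenvector S c x
    Sx≡cx j = begin
      (S · x) j                     ≡⟨ ℤ.*-identityˡ _ ⟨
      1ℤ ℤ.* (S · x) j              ≡⟨ cong (ℤ._* (S · x) j) (sign²≡1 (±p j)) ⟨
      p j ℤ.* p j ℤ.* (S · x) j     ≡⟨ rearrange (p j) ((S · x) j) ⟩
      p j ℤ.* (S · x) j ℤ.* p j     ≡⟨ cong₂ ℤ._*_ (pSx≡c j) (sym (x≡p j)) ⟩
      c ℤ.* x j                     ∎

-- Summing a row of J = 2A + I + S, with A the adjacency matrix, gives n = 2d + 1 + s, so every row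
-- sum s equals n - 1 - 2d.
ambient-regular⇒constant-row-sums :
  (S : Seidel n) (G : Graph n) → IsAmbientGraph S G → Regular G →
  ∃ λ c → ∀ i → sum (matrix S i) ≡ c
ambient-regular⇒constant-row-sums {n} S G ambient (d , degree≡d) =
  -- The order n is left as a sum of ones, the form in which `total` produces it.
  sum (λ (_ : Fin n) → 1ℤ) ℤ.- 1ℤ ℤ.- (+ d ℤ.+ + d) , λ i → begin
    s i                                                       ≡⟨ solve-s (+ d ℤ.+ + d) (s i) ⟩
    ((+ d ℤ.+ + d) ℤ.+ (1ℤ ℤ.+ s i)) ℤ.- 1ℤ ℤ.- (+ d ℤ.+ + d) ≡⟨ cong (λ t → t ℤ.- 1ℤ ℤ.- (+ d ℤ.+ + d)) (total i) ⟨
    sum (λ (_ : Fin n) → 1ℤ) ℤ.- 1ℤ ℤ.- (+ d ℤ.+ + d)         ∎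
  where
  open ≡-Reasoning
  A = Graph.adjacency G

  s : Vector ℤ n
  s i = sum (matrix S i)

  solve-s : ∀ d s → s ≡ (d ℤ.+ (1ℤ ℤ.+ s)) ℤ.- 1ℤ ℤ.- d
  solve-s = solve-∀

  cancel : ∀ a b c → (a ℤ.- b ℤ.- c) ℤ.+ (b ℤ.+ c) ≡ a
  cancel = solve-∀

  entry : ∀ i j → 1ℤ ≡ (A i j ℤ.+ A i j) ℤ.+ (I n i j ℤ.+ matrix S i j)
  entry i j = sym (trans (cong (ℤ._+ (I n i j ℤ.+ matrix S i j)) (ambient i j))
                         (cancel 1ℤ (I n i j) (matrix S i j)))

  sum-I : ∀ i → sum (I n i) ≡ 1ℤ
  sum-I i = trans (sum-supported (I n i) i (λ _ → I-offDiagonal)) (I-diagonal i)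

  sum-A : ∀ i → sum (A i) ≡ + d
  sum-A i = trans (sum-indicator (Graph.adjacent G i)) (cong +_ (degree≡d i))

  total : ∀ i → sum (λ (_ : Fin n) → 1ℤ) ≡ (+ d ℤ.+ + d) ℤ.+ (1ℤ ℤ.+ s i)
  total i = begin
    sum (λ (_ : Fin n) → 1ℤ)
      ≡⟨ sum-cong-≗ (entry i) ⟩
    sum (λ j → (A i j ℤ.+ A i j) ℤ.+ (I n i j ℤ.+ matrix S i j))
      ≡⟨ ∑-distrib-+ (λ j → A i j ℤ.+ A i j) _ ⟩
    sum (λ j → A i j ℤ.+ A i j) ℤ.+ sum (λ j → I n i j ℤ.+ matrix S i j)
      ≡⟨ cong₂ ℤ._+_ (∑-distrib-+ (A i) (A i)) (∑-distrib-+ (I n i) (matrix S i)) ⟩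
    (sum (A i) ℤ.+ sum (A i)) ℤ.+ (sum (I n i) ℤ.+ s i)
      ≡⟨ cong₂ ℤ._+_ (cong₂ ℤ._+_ (sum-A i) (sum-A i)) (cong (ℤ._+ s i) (sum-I i)) ⟩
    (+ d ℤ.+ + d) ℤ.+ (1ℤ ℤ.+ s i) ∎

regular⇒±1-eigenvector :
  (S : Seidel n) → HasRegularInSwitchingClass S →
  ∃₂ λ c x → (∀ i → IsSign (x i)) × IsEigenvector (matrix S) c x
regular⇒±1-eigenvector S (G , (S′ , (P , isP , S′≋PSPᵀ) , ambient) , regular)
  with c , sums≡c ← ambient-regular⇒constant-row-sums S′ G ambient regular =
  c , constant-row-sums⇒±1-eigenvector isP (matrix S) c
        (λ i → trans (sum-cong-≗ (λ j → sym (S′≋PSPᵀ i j))) (sums≡c i))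

-- Block sums

module _ (m : ℕ) (x : Vector ℤ (m * n)) where

  blockSum : Vector ℤ n
  blockSum a = sum (λ b → x (combine {m} b a))

  -- All blocks of J ⊗ B in a given block row equal `B`, so the product sees `x` only through its
  -- block sum and is the same in every block `b`.
  J⊗-· : (B : Matrix ℤ n n) → ∀ b a →
         ((J m ⊗ B) · x) (combine {m} b a) ≡ (B · blockSum) a
  J⊗-· B b a = begin
    ((J m ⊗ B) · x) (combine {m} b a)
      ≡⟨ sum-combine m (λ i → (J m ⊗ B) (combine {m} b a) i ℤ.* x i) ⟩
    sum (λ a′ → sum (λ b′ → (J m ⊗ B) (combine {m} b a) (combine {m} b′ a′) ℤ.* x (combine {m} b′ a′)))
      ≡⟨ sum-cong-≗ (λ a′ → sum-cong-≗ (λ b′ → cong (ℤ._* x (combine {m} b′ a′)) (entry b′ a′))) ⟩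
    sum (λ a′ → sum (λ b′ → B a a′ ℤ.* x (combine {m} b′ a′)))
      ≡⟨ sum-cong-≗ (λ a′ → *-distribˡ-sum (B a a′) (λ b′ → x (combine {m} b′ a′))) ⟨
    (B · blockSum) a ∎
    where
    open ≡-Reasoning
    remainder-combine : ∀ (b : Fin m) a → remainder {m} n (combine {m} b a) ≡ a
    remainder-combine b a = cong proj₂ (remQuot-combine {m} b a)

    entry : ∀ b′ a′ → (J m ⊗ B) (combine {m} b a) (combine {m} b′ a′) ≡ B a a′
    entry b′ a′ = trans (ℤ.*-identityˡ _)
      (cong₂ B (remainder-combine b a) (remainder-combine b′ a′))

  -- With y the block sum and x_b the block `b` of `x`, the eigenvector equation in that block reads
  -- (S - I) y + x_b = c x_b. Adding over all `m` blocks gives m (S - I) y + y = c y.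
  blockSum-eigen : (S : Seidel n) (c : ℤ) →
    IsEigenvector (matrix (J⊗[ S -I]+I m)) c x →
    ∀ a → + m ℤ.* (matrix S · blockSum) a ≡ (+ m ℤ.+ c ℤ.- 1ℤ) ℤ.* blockSum a
  blockSum-eigen S c Mx≡cx a = solve-Sy (+ m) Sy y c (begin
    + m ℤ.* (Sy ℤ.- y) ℤ.+ y
      ≡⟨ cong (λ t → + m ℤ.* t ℤ.+ y) [S-I]y ⟨
    + m ℤ.* By ℤ.+ y
      ≡⟨ cong (ℤ._+ y) (sum-const m By) ⟨
    sum {m} (λ _ → By) ℤ.+ y
      ≡⟨ ∑-distrib-+ {m} (λ _ → By) (λ b → x (combine {m} b a)) ⟨
    sum {m} (λ b → By ℤ.+ x (combine {m} b a))
      ≡⟨ sum-cong-≗ {m} row ⟩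
    sum {m} (λ b → c ℤ.* x (combine {m} b a))
      ≡⟨ *-distribˡ-sum {m} c (λ b → x (combine {m} b a)) ⟨
    c ℤ.* y ∎)
    where
    open ≡-Reasoning
    B = matrix S ⊟ I n
    y = blockSum a
    Sy = (matrix S · blockSum) a
    By = (B · blockSum) a

    [S-I]y : By ≡ Sy ℤ.- y
    [S-I]y = trans (·-distrib-⊞ (matrix S) (⊟ I n) blockSum a)
      (cong (ℤ._+_ Sy) (trans (⊟-· (I n) blockSum a) (cong ℤ.-_ (I·x≡x blockSum a))))

    row : ∀ b → By ℤ.+ x (combine {m} b a) ≡ c ℤ.* x (combine {m} b a)
    row b = begin
      By ℤ.+ x (combine {m} b a)
        ≡⟨ cong₂ ℤ._+_ (J⊗-· B b a) (I·x≡x x (combine {m} b a)) ⟨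
      ((J m ⊗ B) · x) (combine {m} b a) ℤ.+ (I (m * n) · x) (combine {m} b a)
        ≡⟨ ·-distrib-⊞ (J m ⊗ B) (I (m * n)) x (combine {m} b a) ⟨
      (matrix (J⊗[ S -I]+I m) · x) (combine {m} b a)
        ≡⟨ Mx≡cx (combine {m} b a) ⟩
      c ℤ.* x (combine {m} b a) ∎

    solve-Sy : ∀ m s y c → m ℤ.* (s ℤ.- y) ℤ.+ y ≡ c ℤ.* y →
               m ℤ.* s ≡ (m ℤ.+ c ℤ.- 1ℤ) ℤ.* y
    -- Adding (m - 1) y to both sides leaves m s alone on the left.
    solve-Sy m s y c eq = begin
      m ℤ.* s                                            ≡⟨ expand m s y ⟩
      (m ℤ.* (s ℤ.- y) ℤ.+ y) ℤ.+ (m ℤ.- 1ℤ) ℤ.* y       ≡⟨ cong (ℤ._+ (m ℤ.- 1ℤ) ℤ.* y) eq ⟩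
      c ℤ.* y ℤ.+ (m ℤ.- 1ℤ) ℤ.* y                       ≡⟨ collect m y c ⟩
      (m ℤ.+ c ℤ.- 1ℤ) ℤ.* y                             ∎
      where
      expand : ∀ m s y → m ℤ.* s ≡ (m ℤ.* (s ℤ.- y) ℤ.+ y) ℤ.+ (m ℤ.- 1ℤ) ℤ.* y
      expand = solve-∀
      collect : ∀ m y c → c ℤ.* y ℤ.+ (m ℤ.- 1ℤ) ℤ.* y ≡ (m ℤ.+ c ℤ.- 1ℤ) ℤ.* y
      collect = solve-∀

-- Rational eigenvalues

-- Rationals are stored in lowest terms, so the equation is moved to unnormalised fractions, where
-- it becomes the cross-multiplied hypothesis.
/-*-/1 : ∀ p m y z → p ℤ.* y ≡ + suc m ℤ.* z → (p / suc m) ℚ.* (y / 1) ≡ z / 1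
/-*-/1 p m y z eq = ℚ.toℚᵘ-injective (begin
  ℚ.toℚᵘ ((p / suc m) ℚ.* (y / 1))             ≈⟨ ℚ.toℚᵘ-homo-* (p / suc m) (y / 1) ⟩
  ℚ.toℚᵘ (p / suc m) ℚᵘ.* ℚ.toℚᵘ (y / 1)       ≈⟨ ℚᵘ.*-cong (ℚ.toℚᵘ-fromℚᵘ (mkℚᵘ p m)) (ℚ.toℚᵘ-fromℚᵘ (mkℚᵘ y 0)) ⟩
  mkℚᵘ p m ℚᵘ.* mkℚᵘ y 0                       ≈⟨ *≡* cross ⟩
  mkℚᵘ z 0                                     ≈⟨ ℚ.toℚᵘ-fromℚᵘ (mkℚᵘ z 0) ⟨
  ℚ.toℚᵘ (z / 1)                               ∎)
  where
  open import Relation.Binary.Reasoning.Setoid ℚᵘ.≃-setoid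
  cross : p ℤ.* y ℤ.* 1ℤ ≡ z ℤ.* + (suc m * 1)
  cross = trans (ℤ.*-identityʳ _) (trans eq (trans (ℤ.*-comm (+ suc m) z)
            (cong (λ t → z ℤ.* + t) (sym (ℕ.*-identityʳ (suc m))))))

/1-homo-+ : ∀ a b → (a / 1) ℚ.+ (b / 1) ≡ (a ℤ.+ b) / 1
/1-homo-+ a b = ℚ.toℚᵘ-injective (begin
  ℚ.toℚᵘ ((a / 1) ℚ.+ (b / 1))             ≈⟨ ℚ.toℚᵘ-homo-+ (a / 1) (b / 1) ⟩
  ℚ.toℚᵘ (a / 1) ℚᵘ.+ ℚ.toℚᵘ (b / 1)       ≈⟨ ℚᵘ.+-cong (ℚ.toℚᵘ-fromℚᵘ (mkℚᵘ a 0)) (ℚ.toℚᵘ-fromℚᵘ (mkℚᵘ b 0)) ⟩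
  mkℚᵘ a 0 ℚᵘ.+ mkℚᵘ b 0                   ≈⟨ *≡* (cong (ℤ._* 1ℤ) (cong₂ ℤ._+_ (ℤ.*-identityʳ a) (ℤ.*-identityʳ b))) ⟩
  mkℚᵘ (a ℤ.+ b) 0                         ≈⟨ ℚ.toℚᵘ-fromℚᵘ (mkℚᵘ (a ℤ.+ b) 0) ⟨
  ℚ.toℚᵘ ((a ℤ.+ b) / 1)                   ∎)
  where open import Relation.Binary.Reasoning.Setoid ℚᵘ.≃-setoid

/1-injective : ∀ {a b} → a / 1 ≡ b / 1 → a ≡ b
/1-injective {a} {b} eq with ℚ.fromℚᵘ-injective {mkℚᵘ a 0} {mkℚᵘ b 0} eq
... | *≡* a*1≡b*1 = trans (sym (ℤ.*-identityʳ a)) (trans a*1≡b*1 (ℤ.*-identityʳ b))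

rational-* : ∀ a b → ⟨ a , 0ℚ ⟩ K.* ⟨ b , 0ℚ ⟩ ≡ ⟨ a ℚ.* b , 0ℚ ⟩
rational-* a b = cong₂ ⟨_,_⟩
  (ℚ.+-identityʳ (a ℚ.* b))
  (cong₂ ℚ._+_ (ℚ.*-zeroʳ a) (ℚ.*-zeroˡ b))

fromℤ-homo-* : ∀ a b → K.fromℤ a K.* K.fromℤ b ≡ K.fromℤ (a ℤ.* b)
fromℤ-homo-* a b = trans (rational-* (a / 1) (b / 1))
  (cong ⟨_, 0ℚ ⟩ (/-*-/1 a 0 b (a ℤ.* b) (sym (ℤ.*-identityˡ _))))

fromℤ-sum : (f : Vector ℤ n) → K.sum (K.fromℤ ∘ f) ≡ K.fromℤ (sum f)
fromℤ-sum {zero}  f = refl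
fromℤ-sum {suc n} f = trans
  (cong (K._+_ (K.fromℤ (f zero))) (fromℤ-sum (f ∘ suc)))
  (cong ⟨_, 0ℚ ⟩ (/1-homo-+ (f zero) (sum (f ∘ suc))))

K-sum-cong : {f g : Vector ℚ√5 n} → f ≗ g → K.sum f ≡ K.sum g
K-sum-cong {zero}  f≗g = refl
K-sum-cong {suc n} f≗g = cong₂ K._+_ (f≗g zero) (K-sum-cong (f≗g ∘ suc))

apply-fromℤ : (M : Matrix ℤ m n) (y : Vector ℤ n) →
              apply M (K.fromℤ ∘ y) ≗ K.fromℤ ∘ (M · y)
apply-fromℤ M y i = trans
  (K-sum-cong (λ j → fromℤ-homo-* (M i j) (y j)))
  (fromℤ-sum (λ j → M i j ℤ.* y j))

-- The vector `y` is embedded with integer coordinates, so a denominator occurs only in the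
-- eigenvalue. One nonzero coordinate makes it a nonzero vector.
rational-eigenvalue :
  (M : Matrix ℤ n n) (m : ℕ) (p : ℤ) (y : Vector ℤ n) →
  (∀ i → + suc m ℤ.* (M · y) i ≡ p ℤ.* y i) → ∀ i → y i ≢ 0ℤ →
  IsEigenvalue M ⟨ p / suc m , 0ℚ ⟩
rational-eigenvalue M m p y mMy≡py i yᵢ≢0 =
  K.fromℤ ∘ y ,
  (λ j → trans (apply-fromℤ M y j)
           (sym (trans (rational-* (p / suc m) (y j / 1))
                  (cong ⟨_, 0ℚ ⟩ (/-*-/1 p m (y j) _ (sym (mMy≡py j))))))) ,
  λ y≗0 → yᵢ≢0 (/1-injective (cong ℚ√5.rational (y≗0 i)))

-- Otherwise (m + c - 1) / m would be a rational eigenvalue of `S`, with the block sum as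
-- eigenvector. Its coordinate at `zero`, available because the order is `suc n`, is a sum of an odd
-- number of signs and so is nonzero.
no-±1-eigenvector :
  (S : Seidel (suc n)) → (∀ q → ¬ IsEigenvalue (matrix S) ⟨ q , 0ℚ ⟩) →
  ¬ 2 ∣ m → ∀ c x → (∀ i → IsSign (x i)) →
  ¬ IsEigenvector (matrix (J⊗[ S -I]+I m)) c x
no-±1-eigenvector {m = zero}  S irrational 2∤0 c x ±x Mx≡cx = 2∤0 (2 ∣0)
no-±1-eigenvector {m = suc m} S irrational 2∤m c x ±x Mx≡cx =
  irrational (p / suc m)
    (rational-eigenvalue (matrix S) m p (blockSum (suc m) x)
      (blockSum-eigen (suc m) x S c Mx≡cx) zero
      (sum-signs≢0 2∤m (λ b → x (combine {suc m} b zero)) (λ b → ±x (combine b zero))))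
  where
  p : ℤ
  p = + suc m ℤ.+ c ℤ.- 1ℤ

mainTheorem3 : (S₆ : Seidel 6) →
    HasSpectrum S₆ ((K.- K.√5 , 3) ∷ (K.√5 , 3) ∷ []) →
    (k : ℕ) → k ≡ 1 ⊎ k ≡ 2 →
    ¬ HasRegularInSwitchingClass (J⊗[ S₆ -I]+I (2 * k + 1)) ×
    ¬ HasRegularInSwitchingClass (negate (J⊗[ S₆ -I]+I (2 * k + 1)))
mainTheorem3 S₆ spectrum k _ = positive , negative
  where
  T : Seidel ((2 * k + 1) * 6)
  T = J⊗[ S₆ -I]+I (2 * k + 1)

  2∤2k+1 : ¬ 2 ∣ 2 * k + 1
  -- As 2 divides 2k, it would have to divide the remaining 1.
  2∤2k+1 2∣2k+1 = >⇒∤ (ℕ.s≤s (ℕ.s≤s ℕ.z≤n)) (∣m+n∣m⇒∣n 2∣2k+1 (m∣m*n k))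

  irrational : ∀ q → ¬ IsEigenvalue (matrix S₆) ⟨ q , 0ℚ ⟩
  irrational q eigenvalue
    with Equivalence.to (HasSpectrum.eigenvalues spectrum ⟨ q , 0ℚ ⟩) eigenvalue
  -- Both listed eigenvalues have a nonzero √5-component, whereas that of `⟨ q , 0ℚ ⟩` is zero.
  ... | here eq         with () ← cong ℚ√5.irrational eq
  ... | there (here eq) with () ← cong ℚ√5.irrational eq

  positive : ¬ HasRegularInSwitchingClass T
  positive regular with c , x , ±x , Tx≡cx ← regular⇒±1-eigenvector T regular =
    no-±1-eigenvector S₆ irrational 2∤2k+1 c x ±x Tx≡cx

  negative : ¬ HasRegularInSwitchingClass (negate T)
  negative regular with c , x , ±x , -Tx≡cx ← regular⇒±1-eigenvector (negate T) regular =
    -- The same `x` is an eigenvector of `T`, with the eigenvalue negated.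
    no-±1-eigenvector S₆ irrational 2∤2k+1 (ℤ.- c) x ±x λ i → begin
      (matrix T · x) i             ≡⟨ ℤ.neg-involutive _ ⟨
      ℤ.- (ℤ.- (matrix T · x) i)   ≡⟨ cong ℤ.-_ (⊟-· (matrix T) x i) ⟨
      ℤ.- ((⊟ matrix T) · x) i     ≡⟨ cong ℤ.-_ (-Tx≡cx i) ⟩
      ℤ.- (c ℤ.* x i)              ≡⟨ ℤ.neg-distribˡ-* c (x i) ⟩
      ℤ.- c ℤ.* x i                ∎
    where open ≡-Reasoning
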